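{- For every set of formulas $\Gamma\cup\{A\}\subseteq For(\Sigma)$: if $\Gamma\vdash_{LET_K^+}A$ then $\Gamma\models_{\mathcal{M}_6}A$.
   Context: $For(\Sigma)$ is the set of formulas over a denumerable set of propositional variables and $\Sigma=\{\land,\lor,\to,\neg,\circ\}$. The logic $LET_K$ is the natural deduction system with rules: ($\land$I) from $A,B$ infer $A\land B$; ($\land$E) from $A\land B$ infer $A$ and $B$; ($\lor$I) from $A$ (or from $B$) infer $A\lor B$; ($\lor$E) from $A\lor B$ and derivations of $C$ from $[A]$ and from $[B]$ infer $C$; ($\neg\land$I) from $\neg A$ (or $\neg B$) infer $\neg(A\land B)$; ($\neg\land$E) from $\neg(A\land B)$ and derivations of $C$ from $[\neg A]$ and from $[\neg B]$ infer $C$; ($\neg\lor$I) from $\neg A,\neg B$ infer $\neg(A\lor B)$; ($\neg\lor$E) from $\neg(A\lor B)$ infer $\neg A$ and $\neg B$; (DN) $A$ and $\neg\neg A$ are inter-derivable; ($\to$I) from a derivation of $B$ from $[A]$ infer $A\to B$; ($\to$E) from $A\to B$ and $A$ infer $B$; ($\to_{CL}$) axiom $A\lor(A\to B)$; ($\neg\to$I) from $A,\neg B$ infer $\neg(A\to B)$; ($\neg\to$E) from $\neg(A\to B)$ infer $A$ and $\neg B$; (EXP$^\circ$) from $\circ A,A,\neg A$ infer $B$; (PEM$^\circ$) from $\circ A$ infer $A\lor\neg A$ (bracketed hypotheses are discharged). Write $A^T$ for $\circ A\land A$, $A^F$ for $\circ A\land\neg A$. $LET_K^+$ adds: (I$\circ$)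 axiom $\circ\circ A$; (I$\neg\circ$) from $\circ A$ infer $\circ\neg A$; (E$\neg\circ$) from $\circ\neg A$ infer $\circ A$; (I$\land$T) from $A^T,B^T$ infer $(A\land B)^T$; (I$\land$F) from $A^F$ (or $B^F$) infer $(A\land B)^F$; (I$\lor$T) from $A^T$ (or $B^T$) infer $(A\lor B)^T$; (I$\lor$F) from $A^F,B^F$ infer $(A\lor B)^F$; (I$\to$T) from $A^F$ (or $B^T$) infer $(A\to B)^T$; (I$\to$F) from $A,B^F$ infer $(A\to B)^F$; (E$\land$T) from $(A\land B)^T$ infer $A^T$ and $B^T$; (E$\land$F) from $(A\land B)^F$ and derivations of $C$ from $[A^F]$ and from $[B^F]$ infer $C$; (E$\lor$T) from $(A\lor B)^T$ and derivations of $C$ from $[A^T]$ and from $[B^T]$ infer $C$; (E$\lor$F) from $(A\lor B)^F$ infer $A^F$ and $B^F$; (E$\to$T) from $(A\to B)^T$ and derivations of $C$ from $[A^F]$ and from $[B^T]$ infer $C$; (E$\to$F) from $(A\to B)^F$ infer $A$ and $B^F$. $\Gamma\vdash_{LET_K^+}A$ means derivability from premises in $\Gamma$. Let $\{0,1\}$ be the two-element Boolean algebra with $\sqcap,\sqcup,\sim$, $a\Rightarrow b=\sim a\sqcup b$. $\mathcal{M}_6$ is the logical matrix with domain $B_{LET_K}=\{z\in\{0,1\}^3:z_3\le z_1\sqcup z_2,\ z_1\sqcap z_2\sqcap z_3=0\}=\{T=(1,0,1),T_0=(1,0,0),\mathsf{b}=(1,1,0),\mathsf{n}=(0,0,0),F_0=(0,1,0),F=(0,1,1)\}$,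 designated set $\mathrm{D}=\{T,T_0,\mathsf{b}\}$, and operations: $z\tilde\land w=(z_1\sqcap w_1,\ z_2\sqcup w_2,\ (z_1\sqcap z_3\sqcap w_1\sqcap w_3)\sqcup(z_2\sqcap z_3)\sqcup(w_2\sqcap w_3))$; $z\tilde\lor w=(z_1\sqcup w_1,\ z_2\sqcap w_2,\ (z_2\sqcap z_3\sqcap w_2\sqcap w_3)\sqcup(z_1\sqcap z_3)\sqcup(w_1\sqcap w_3))$; $z\tilde\to w=(z_1\Rightarrow w_1,\ z_1\sqcap w_2,\ (z_1\sqcap w_2\sqcap w_3)\sqcup(z_2\sqcap z_3)\sqcup(w_1\sqcap w_3))$; $\tilde\neg z=(z_2,z_1,z_3)$; $\tilde\circ z=(z_3,\sim z_3,1)$. A valuation is a homomorphism from the formula algebra into this algebra; $\Gamma\models_{\mathcal{M}_6}A$ iff every valuation sending all formulas of $\Gamma$ into $\mathrm{D}$ sends $A$ into $\mathrm{D}$. -}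

module Defs where

open import Data.Nat using (ℕ)
open import Data.Bool using (Bool; true; false; _∧_; _∨_; not; T)
open import Data.Product using (Σ; _×_; _,_; proj₁; proj₂)
open import Data.Sum using (_⊎_)
open import Relation.Binary.PropositionalEquality using (_≡_; refl)

infixr 6 _∧'_
infixr 5 _∨'_
infixr 4 _⇒_
infix 9 ¬'_ ∘_
infixl 1 _,,_

data For : Set where
  var  : ℕ → For
  _∧'_ : For → For → For
  _∨'_ : For → For → For
  _⇒_  : For → For → For
  ¬'_  : For → For
  ∘_   : For → For

_ᵀ : For → For
A ᵀ = (∘ A) ∧' A

_ᶠ : For → For
A ᶠ = (∘ A) ∧' (¬' A)

FSet : Set₁
FSet = For → Set

_,,_ : FSet → For → FSet
(Γ ,, A) X = Γ X ⊎ X ≡ A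

infix 2 _⊢_

data _⊢_ (Γ : FSet) : For → Set₁ where
  hyp   : ∀ {A} → Γ A → Γ ⊢ A
  -- LET_K
  ∧I    : ∀ {A B} → Γ ⊢ A → Γ ⊢ B → Γ ⊢ A ∧' B
  ∧E₁   : ∀ {A B} → Γ ⊢ A ∧' B → Γ ⊢ A
  ∧E₂   : ∀ {A B} → Γ ⊢ A ∧' B → Γ ⊢ B
  ∨I₁   : ∀ {A B} → Γ ⊢ A → Γ ⊢ A ∨' B
  ∨I₂   : ∀ {A B} → Γ ⊢ B → Γ ⊢ A ∨' B
  ∨E    : ∀ {A B C} → Γ ⊢ A ∨' B → (Γ ,, A) ⊢ C → (Γ ,, B) ⊢ C → Γ ⊢ C
  ¬∧I₁  : ∀ {A B} → Γ ⊢ ¬' A → Γ ⊢ ¬' (A ∧' B)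
  ¬∧I₂  : ∀ {A B} → Γ ⊢ ¬' B → Γ ⊢ ¬' (A ∧' B)
  ¬∧E   : ∀ {A B C} → Γ ⊢ ¬' (A ∧' B) → (Γ ,, ¬' A) ⊢ C → (Γ ,, ¬' B) ⊢ C → Γ ⊢ C
  ¬∨I   : ∀ {A B} → Γ ⊢ ¬' A → Γ ⊢ ¬' B → Γ ⊢ ¬' (A ∨' B)
  ¬∨E₁  : ∀ {A B} → Γ ⊢ ¬' (A ∨' B) → Γ ⊢ ¬' A
  ¬∨E₂  : ∀ {A B} → Γ ⊢ ¬' (A ∨' B) → Γ ⊢ ¬' B
  DNI   : ∀ {A} → Γ ⊢ A → Γ ⊢ ¬' (¬' A)
  DNE   : ∀ {A} → Γ ⊢ ¬' (¬' A) → Γ ⊢ A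
  ⇒I    : ∀ {A B} → (Γ ,, A) ⊢ B → Γ ⊢ A ⇒ B
  ⇒E    : ∀ {A B} → Γ ⊢ A ⇒ B → Γ ⊢ A → Γ ⊢ B
  ⇒CL   : ∀ {A B} → Γ ⊢ A ∨' (A ⇒ B)
  ¬⇒I   : ∀ {A B} → Γ ⊢ A → Γ ⊢ ¬' B → Γ ⊢ ¬' (A ⇒ B)
  ¬⇒E₁  : ∀ {A B} → Γ ⊢ ¬' (A ⇒ B) → Γ ⊢ A
  ¬⇒E₂  : ∀ {A B} → Γ ⊢ ¬' (A ⇒ B) → Γ ⊢ ¬' B
  EXP∘  : ∀ {A B} → Γ ⊢ ∘ A → Γ ⊢ A → Γ ⊢ ¬' A → Γ ⊢ B
  PEM∘  : ∀ {A} → Γ ⊢ ∘ A → Γ ⊢ A ∨' (¬' A)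
  -- LET_K^+ additions
  I∘    : ∀ {A} → Γ ⊢ ∘ (∘ A)
  I¬∘   : ∀ {A} → Γ ⊢ ∘ A → Γ ⊢ ∘ (¬' A)
  E¬∘   : ∀ {A} → Γ ⊢ ∘ (¬' A) → Γ ⊢ ∘ A
  I∧T   : ∀ {A B} → Γ ⊢ A ᵀ → Γ ⊢ B ᵀ → Γ ⊢ (A ∧' B) ᵀ
  I∧F₁  : ∀ {A B} → Γ ⊢ A ᶠ → Γ ⊢ (A ∧' B) ᶠ
  I∧F₂  : ∀ {A B} → Γ ⊢ B ᶠ → Γ ⊢ (A ∧' B) ᶠ
  I∨T₁  : ∀ {A B} → Γ ⊢ A ᵀ → Γ ⊢ (A ∨' B) ᵀ
  I∨T₂  : ∀ {A B} → Γ ⊢ B ᵀ → Γ ⊢ (A ∨' B) ᵀ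
  I∨F   : ∀ {A B} → Γ ⊢ A ᶠ → Γ ⊢ B ᶠ → Γ ⊢ (A ∨' B) ᶠ
  I⇒T₁  : ∀ {A B} → Γ ⊢ A ᶠ → Γ ⊢ (A ⇒ B) ᵀ
  I⇒T₂  : ∀ {A B} → Γ ⊢ B ᵀ → Γ ⊢ (A ⇒ B) ᵀ
  I⇒F   : ∀ {A B} → Γ ⊢ A → Γ ⊢ B ᶠ → Γ ⊢ (A ⇒ B) ᶠ
  E∧T₁  : ∀ {A B} → Γ ⊢ (A ∧' B) ᵀ → Γ ⊢ A ᵀ
  E∧T₂  : ∀ {A B} → Γ ⊢ (A ∧' B) ᵀ → Γ ⊢ B ᵀ
  E∧F   : ∀ {A B C} → Γ ⊢ (A ∧' B) ᶠ → (Γ ,, A ᶠ) ⊢ C → (Γ ,, B ᶠ) ⊢ C → Γ ⊢ C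
  E∨T   : ∀ {A B C} → Γ ⊢ (A ∨' B) ᵀ → (Γ ,, A ᵀ) ⊢ C → (Γ ,, B ᵀ) ⊢ C → Γ ⊢ C
  E∨F₁  : ∀ {A B} → Γ ⊢ (A ∨' B) ᶠ → Γ ⊢ A ᶠ
  E∨F₂  : ∀ {A B} → Γ ⊢ (A ∨' B) ᶠ → Γ ⊢ B ᶠ
  E⇒T   : ∀ {A B C} → Γ ⊢ (A ⇒ B) ᵀ → (Γ ,, A ᶠ) ⊢ C → (Γ ,, B ᵀ) ⊢ C → Γ ⊢ C
  E⇒F₁  : ∀ {A B} → Γ ⊢ (A ⇒ B) ᶠ → Γ ⊢ A
  E⇒F₂  : ∀ {A B} → Γ ⊢ (A ⇒ B) ᶠ → Γ ⊢ B ᶠ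

_⟹_ : Bool → Bool → Bool
a ⟹ b = not a ∨ b

Triple : Set
Triple = Bool × Bool × Bool

inB : Triple → Bool
inB (z1 , z2 , z3) = (z3 ⟹ (z1 ∨ z2)) ∧ not (z1 ∧ z2 ∧ z3)

B6 : Set
B6 = Σ Triple (λ z → T (inB z))

and3 : Triple → Triple → Triple
and3 (z1 , z2 , z3) (w1 , w2 , w3) =
  (z1 ∧ w1 , z2 ∨ w2 , ((z1 ∧ z3 ∧ w1 ∧ w3) ∨ (z2 ∧ z3)) ∨ (w2 ∧ w3))

or3 : Triple → Triple → Triple
or3 (z1 , z2 , z3) (w1 , w2 , w3) =
  (z1 ∨ w1 , z2 ∧ w2 , ((z2 ∧ z3 ∧ w2 ∧ w3) ∨ (z1 ∧ z3)) ∨ (w1 ∧ w3))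

imp3 : Triple → Triple → Triple
imp3 (z1 , z2 , z3) (w1 , w2 , w3) =
  (z1 ⟹ w1 , z1 ∧ w2 , ((z1 ∧ w2 ∧ w3) ∨ (z2 ∧ z3)) ∨ (w1 ∧ w3))

neg3 : Triple → Triple
neg3 (z1 , z2 , z3) = (z2 , z1 , z3)

circ3 : Triple → Triple
circ3 (z1 , z2 , z3) = (z3 , not z3 , true)

and-cl : ∀ z w → T (inB z) → T (inB w) → T (inB (and3 z w))
and-cl (false , false , false) (false , false , false) _ _ = _
and-cl (false , false , false) (false , false , true) _ ()
and-cl (false , false , false) (false , true , false) _ _ = _
and-cl (false , false , false) (false , true , true) _ _ = _
and-cl (false , false , false) (true , false , false) _ _ = _
and-cl (false , false , false) (true , false , true) _ _ = _
and-cl (false , false , false) (true , true , false) _ _ = _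
and-cl (false , false , false) (true , true , true) _ ()
and-cl (false , false , true) (false , false , false) () _
and-cl (false , false , true) (false , false , true) () _
and-cl (false , false , true) (false , true , false) () _
and-cl (false , false , true) (false , true , true) () _
and-cl (false , false , true) (true , false , false) () _
and-cl (false , false , true) (true , false , true) () _
and-cl (false , false , true) (true , true , false) () _
and-cl (false , false , true) (true , true , true) () _
and-cl (false , true , false) (false , false , false) _ _ = _
and-cl (false , true , false) (false , false , true) _ ()
and-cl (false , true , false) (false , true , false) _ _ = _
and-cl (false , true , false) (false , true , true) _ _ = _
and-cl (false , true , false) (true , false , false) _ _ = _
and-cl (false , true , false) (true , false , true) _ _ = _
and-cl (false , true , false) (true , true , false) _ _ = _
and-cl (false , true , false) (true , true , true) _ ()
and-cl (false , true , true) (false , false , false) _ _ = _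
and-cl (false , true , true) (false , false , true) _ ()
and-cl (false , true , true) (false , true , false) _ _ = _
and-cl (false , true , true) (false , true , true) _ _ = _
and-cl (false , true , true) (true , false , false) _ _ = _
and-cl (false , true , true) (true , false , true) _ _ = _
and-cl (false , true , true) (true , true , false) _ _ = _
and-cl (false , true , true) (true , true , true) _ ()
and-cl (true , false , false) (false , false , false) _ _ = _
and-cl (true , false , false) (false , false , true) _ ()
and-cl (true , false , false) (false , true , false) _ _ = _
and-cl (true , false , false) (false , true , true) _ _ = _
and-cl (true , false , false) (true , false , false) _ _ = _
and-cl (true , false , false) (true , false , true) _ _ = _
and-cl (true , false , false) (true , true , false) _ _ = _
and-cl (true , false , false) (true , true , true) _ ()
and-cl (true , false , true) (false , false , false) _ _ = _
and-cl (true , false , true) (false , false , true) _ ()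
and-cl (true , false , true) (false , true , false) _ _ = _
and-cl (true , false , true) (false , true , true) _ _ = _
and-cl (true , false , true) (true , false , false) _ _ = _
and-cl (true , false , true) (true , false , true) _ _ = _
and-cl (true , false , true) (true , true , false) _ _ = _
and-cl (true , false , true) (true , true , true) _ ()
and-cl (true , true , false) (false , false , false) _ _ = _
and-cl (true , true , false) (false , false , true) _ ()
and-cl (true , true , false) (false , true , false) _ _ = _
and-cl (true , true , false) (false , true , true) _ _ = _
and-cl (true , true , false) (true , false , false) _ _ = _
and-cl (true , true , false) (true , false , true) _ _ = _
and-cl (true , true , false) (true , true , false) _ _ = _
and-cl (true , true , false) (true , true , true) _ ()
and-cl (true , true , true) (false , false , false) () _
and-cl (true , true , true) (false , false , true) () _
and-cl (true , true , true) (false , true , false) () _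
and-cl (true , true , true) (false , true , true) () _
and-cl (true , true , true) (true , false , false) () _
and-cl (true , true , true) (true , false , true) () _
and-cl (true , true , true) (true , true , false) () _
and-cl (true , true , true) (true , true , true) () _
or-cl : ∀ z w → T (inB z) → T (inB w) → T (inB (or3 z w))
or-cl (false , false , false) (false , false , false) _ _ = _
or-cl (false , false , false) (false , false , true) _ ()
or-cl (false , false , false) (false , true , false) _ _ = _
or-cl (false , false , false) (false , true , true) _ _ = _
or-cl (false , false , false) (true , false , false) _ _ = _
or-cl (false , false , false) (true , false , true) _ _ = _
or-cl (false , false , false) (true , true , false) _ _ = _
or-cl (false , false , false) (true , true , true) _ ()
or-cl (false , false , true) (false , false , false) () _
or-cl (false , false , true) (false , false , true) () _
or-cl (false , false , true) (false , true , false) () _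
or-cl (false , false , true) (false , true , true) () _
or-cl (false , false , true) (true , false , false) () _
or-cl (false , false , true) (true , false , true) () _
or-cl (false , false , true) (true , true , false) () _
or-cl (false , false , true) (true , true , true) () _
or-cl (false , true , false) (false , false , false) _ _ = _
or-cl (false , true , false) (false , false , true) _ ()
or-cl (false , true , false) (false , true , false) _ _ = _
or-cl (false , true , false) (false , true , true) _ _ = _
or-cl (false , true , false) (true , false , false) _ _ = _
or-cl (false , true , false) (true , false , true) _ _ = _
or-cl (false , true , false) (true , true , false) _ _ = _
or-cl (false , true , false) (true , true , true) _ ()
or-cl (false , true , true) (false , false , false) _ _ = _
or-cl (false , true , true) (false , false , true) _ ()
or-cl (false , true , true) (false , true , false) _ _ = _
or-cl (false , true , true) (false , true , true) _ _ = _
or-cl (false , true , true) (true , false , false) _ _ = _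
or-cl (false , true , true) (true , false , true) _ _ = _
or-cl (false , true , true) (true , true , false) _ _ = _
or-cl (false , true , true) (true , true , true) _ ()
or-cl (true , false , false) (false , false , false) _ _ = _
or-cl (true , false , false) (false , false , true) _ ()
or-cl (true , false , false) (false , true , false) _ _ = _
or-cl (true , false , false) (false , true , true) _ _ = _
or-cl (true , false , false) (true , false , false) _ _ = _
or-cl (true , false , false) (true , false , true) _ _ = _
or-cl (true , false , false) (true , true , false) _ _ = _
or-cl (true , false , false) (true , true , true) _ ()
or-cl (true , false , true) (false , false , false) _ _ = _
or-cl (true , false , true) (false , false , true) _ ()
or-cl (true , false , true) (false , true , false) _ _ = _
or-cl (true , false , true) (false , true , true) _ _ = _
or-cl (true , false , true) (true , false , false) _ _ = _
or-cl (true , false , true) (true , false , true) _ _ = _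
or-cl (true , false , true) (true , true , false) _ _ = _
or-cl (true , false , true) (true , true , true) _ ()
or-cl (true , true , false) (false , false , false) _ _ = _
or-cl (true , true , false) (false , false , true) _ ()
or-cl (true , true , false) (false , true , false) _ _ = _
or-cl (true , true , false) (false , true , true) _ _ = _
or-cl (true , true , false) (true , false , false) _ _ = _
or-cl (true , true , false) (true , false , true) _ _ = _
or-cl (true , true , false) (true , true , false) _ _ = _
or-cl (true , true , false) (true , true , true) _ ()
or-cl (true , true , true) (false , false , false) () _
or-cl (true , true , true) (false , false , true) () _
or-cl (true , true , true) (false , true , false) () _
or-cl (true , true , true) (false , true , true) () _
or-cl (true , true , true) (true , false , false) () _
or-cl (true , true , true) (true , false , true) () _
or-cl (true , true , true) (true , true , false) () _
or-cl (true , true , true) (true , true , true) () _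
imp-cl : ∀ z w → T (inB z) → T (inB w) → T (inB (imp3 z w))
imp-cl (false , false , false) (false , false , false) _ _ = _
imp-cl (false , false , false) (false , false , true) _ ()
imp-cl (false , false , false) (false , true , false) _ _ = _
imp-cl (false , false , false) (false , true , true) _ _ = _
imp-cl (false , false , false) (true , false , false) _ _ = _
imp-cl (false , false , false) (true , false , true) _ _ = _
imp-cl (false , false , false) (true , true , false) _ _ = _
imp-cl (false , false , false) (true , true , true) _ ()
imp-cl (false , false , true) (false , false , false) () _
imp-cl (false , false , true) (false , false , true) () _
imp-cl (false , false , true) (false , true , false) () _
imp-cl (false , false , true) (false , true , true) () _
imp-cl (false , false , true) (true , false , false) () _
imp-cl (false , false , true) (true , false , true) () _
imp-cl (false , false , true) (true , true , false) () _
imp-cl (false , false , true) (true , true , true) () _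
imp-cl (false , true , false) (false , false , false) _ _ = _
imp-cl (false , true , false) (false , false , true) _ ()
imp-cl (false , true , false) (false , true , false) _ _ = _
imp-cl (false , true , false) (false , true , true) _ _ = _
imp-cl (false , true , false) (true , false , false) _ _ = _
imp-cl (false , true , false) (true , false , true) _ _ = _
imp-cl (false , true , false) (true , true , false) _ _ = _
imp-cl (false , true , false) (true , true , true) _ ()
imp-cl (false , true , true) (false , false , false) _ _ = _
imp-cl (false , true , true) (false , false , true) _ ()
imp-cl (false , true , true) (false , true , false) _ _ = _
imp-cl (false , true , true) (false , true , true) _ _ = _
imp-cl (false , true , true) (true , false , false) _ _ = _
imp-cl (false , true , true) (true , false , true) _ _ = _
imp-cl (false , true , true) (true , true , false) _ _ = _
imp-cl (false , true , true) (true , true , true) _ ()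
imp-cl (true , false , false) (false , false , false) _ _ = _
imp-cl (true , false , false) (false , false , true) _ ()
imp-cl (true , false , false) (false , true , false) _ _ = _
imp-cl (true , false , false) (false , true , true) _ _ = _
imp-cl (true , false , false) (true , false , false) _ _ = _
imp-cl (true , false , false) (true , false , true) _ _ = _
imp-cl (true , false , false) (true , true , false) _ _ = _
imp-cl (true , false , false) (true , true , true) _ ()
imp-cl (true , false , true) (false , false , false) _ _ = _
imp-cl (true , false , true) (false , false , true) _ ()
imp-cl (true , false , true) (false , true , false) _ _ = _
imp-cl (true , false , true) (false , true , true) _ _ = _
imp-cl (true , false , true) (true , false , false) _ _ = _
imp-cl (true , false , true) (true , false , true) _ _ = _
imp-cl (true , false , true) (true , true , false) _ _ = _
imp-cl (true , false , true) (true , true , true) _ ()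
imp-cl (true , true , false) (false , false , false) _ _ = _
imp-cl (true , true , false) (false , false , true) _ ()
imp-cl (true , true , false) (false , true , false) _ _ = _
imp-cl (true , true , false) (false , true , true) _ _ = _
imp-cl (true , true , false) (true , false , false) _ _ = _
imp-cl (true , true , false) (true , false , true) _ _ = _
imp-cl (true , true , false) (true , true , false) _ _ = _
imp-cl (true , true , false) (true , true , true) _ ()
imp-cl (true , true , true) (false , false , false) () _
imp-cl (true , true , true) (false , false , true) () _
imp-cl (true , true , true) (false , true , false) () _
imp-cl (true , true , true) (false , true , true) () _
imp-cl (true , true , true) (true , false , false) () _
imp-cl (true , true , true) (true , false , true) () _
imp-cl (true , true , true) (true , true , false) () _
imp-cl (true , true , true) (true , true , true) () _
neg-cl : ∀ z → T (inB z) → T (inB (neg3 z))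
neg-cl (false , false , false) _ = _
neg-cl (false , false , true) ()
neg-cl (false , true , false) _ = _
neg-cl (false , true , true) _ = _
neg-cl (true , false , false) _ = _
neg-cl (true , false , true) _ = _
neg-cl (true , true , false) _ = _
neg-cl (true , true , true) ()
circ-cl : ∀ z → T (inB z) → T (inB (circ3 z))
circ-cl (false , false , false) _ = _
circ-cl (false , false , true) ()
circ-cl (false , true , false) _ = _
circ-cl (false , true , true) _ = _
circ-cl (true , false , false) _ = _
circ-cl (true , false , true) _ = _
circ-cl (true , true , false) _ = _
circ-cl (true , true , true) ()

_∧̃_ : B6 → B6 → B6
(z , p) ∧̃ (w , q) = and3 z w , and-cl z w p q

_∨̃_ : B6 → B6 → B6
(z , p) ∨̃ (w , q) = or3 z w , or-cl z w p q

_→̃_ : B6 → B6 → B6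
(z , p) →̃ (w , q) = imp3 z w , imp-cl z w p q

¬̃ : B6 → B6
¬̃ (z , p) = neg3 z , neg-cl z p

∘̃ : B6 → B6
∘̃ (z , p) = circ3 z , circ-cl z p

-- designated values D = {T, T0, b} = the elements with first coordinate 1
Designated : B6 → Set
Designated ((z1 , z2 , z3) , _) = z1 ≡ true

-- valuations: homomorphisms For → M_6, i.e. the unique extension of an
-- assignment of the propositional variables
⟦_⟧ : For → (ℕ → B6) → B6
⟦ var n ⟧ v = v n
⟦ A ∧' B ⟧ v = ⟦ A ⟧ v ∧̃ ⟦ B ⟧ v
⟦ A ∨' B ⟧ v = ⟦ A ⟧ v ∨̃ ⟦ B ⟧ v
⟦ A ⇒ B ⟧ v = ⟦ A ⟧ v →̃ ⟦ B ⟧ v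
⟦ ¬' A ⟧ v = ¬̃ (⟦ A ⟧ v)
⟦ ∘ A ⟧ v = ∘̃ (⟦ A ⟧ v)

infix 2 _⊨_
_⊨_ : FSet → For → Set
Γ ⊨ A = (v : ℕ → B6) → (∀ X → Γ X → Designated (⟦ X ⟧ v)) → Designated (⟦ A ⟧ v)

{-# OPTIONS --safe #-}
module Submission where

-- Call a formula in two variables valid if it is designated under all 36
-- assignments. Apart from →I and the rules that discharge hypotheses in two
-- subderivations, every rule A₁, …, Aₙ / B is the instance of a valid formula
-- A₁ → … → Aₙ → B, and designation is closed under modus ponens. The rules with
-- two discharging subderivations split a disjunction C ∨ D obtained from the
-- major premise, since C ∨ D is designated only if C or D is; →I splits A ∨ (A → B).

open import Defs
open import Data.Bool using (true; false; _∨_)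
open import Data.Bool.Properties using () renaming (_≟_ to _≟ᵇ_)
open import Data.List using (List; []; _∷_)
open import Data.List.Membership.Propositional using (_∈_)
open import Data.List.Relation.Unary.All as All using ()
open import Data.List.Relation.Unary.Any using (here; there)
open import Data.Nat using (ℕ; zero; suc)
open import Data.Product using (_,_)
open import Data.Sum using (inj₁; inj₂)
open import Relation.Binary.PropositionalEquality using (_≡_; refl)
open import Relation.Nullary using (Dec)
open import Relation.Nullary.Decidable using (True; toWitness; map′)

elements : List B6
elements =
  ((true  , false , true ) , _) ∷
  ((true  , false , false) , _) ∷
  ((true  , true  , false) , _) ∷
  ((false , false , false) , _) ∷
  ((false , true  , false) , _) ∷
  ((false , true  , true ) , _) ∷ []

-- The triples `(false , false , true)` and `(true , true , true)` have an empty proof component, so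
-- they give no case. For the other six that component lies in the unit type, whence `refl`.
∈-elements : ∀ z → z ∈ elements
∈-elements ((true  , false , true ) , _) = here refl
∈-elements ((true  , false , false) , _) = there (here refl)
∈-elements ((true  , true  , false) , _) = there (there (here refl))
∈-elements ((false , false , false) , _) = there (there (there (here refl)))
∈-elements ((false , true  , false) , _) = there (there (there (there (here refl))))
∈-elements ((false , true  , true ) , _) = there (there (there (there (there (here refl)))))

∀B6? : {P : B6 → Set} → (∀ z → Dec (P z)) → Dec (∀ z → P z)
∀B6? P? = map′ (λ ps z → All.lookup ps (∈-elements z)) (λ f → All.universal f elements)
               (All.all? P? elements)

Designated? : ∀ z → Dec (Designated z)
Designated? ((z₁ , _ , _) , _) = z₁ ≟ᵇ true

P Q : For
P = var 0
Q = var 1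

assign : B6 → B6 → ℕ → B6
assign z w zero    = z
assign z w (suc _) = w

Valid : For → Set
Valid S = ∀ z w → Designated (⟦ S ⟧ (assign z w))

valid? : ∀ S → Dec (Valid S)
valid? S = ∀B6? λ z → ∀B6? λ w → Designated? (⟦ S ⟧ (assign z w))

infixl 5 _·_

-- The first coordinate of `imp3` is `⟹`, and designation reads only that coordinate, so this is
-- modus ponens for designated formulas.
_·_ : ∀ {a b} → a ⟹ b ≡ true → a ≡ true → b ≡ true
p · refl = p

∨-case : ∀ {a b} {C : Set} → a ∨ b ≡ true → (a ≡ true → C) → (b ≡ true → C) → C
∨-case {true}  _ f _ = f refl
∨-case {false} p _ g = g p

module _ (v : ℕ → B6) where

  ⊩_ : For → Set
  ⊩ A = Designated (⟦ A ⟧ v)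

  ⊩ˢ_ : FSet → Set
  ⊩ˢ Γ = ∀ X → Γ X → ⊩ X

  extend : ∀ {Γ A} → ⊩ˢ Γ → ⊩ A → ⊩ˢ (Γ ,, A)
  extend h a X (inj₁ x)    = h X x
  extend h a X (inj₂ refl) = a

  -- For a concrete `S` the implicit argument is settled by evaluating the finite check. The result
  -- type unfolds to the designation under `v` of `S` with `A`, `B` put for `P`, `Q`, so
  -- substitution happens by computation.
  instantiate : ∀ S {_ : True (valid? S)} A B → Designated (⟦ S ⟧ (assign (⟦ A ⟧ v) (⟦ B ⟧ v)))
  instantiate S {ok} A B = toWitness ok (⟦ A ⟧ v) (⟦ B ⟧ v)

  sound : ∀ {Γ A} → ⊩ˢ Γ → Γ ⊢ A → ⊩ A
  sound h (hyp x) = h _ x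
  sound h (∧I {A} {B} d e) = instantiate (P ⇒ Q ⇒ P ∧' Q) A B · sound h d · sound h e
  sound h (∧E₁ {A} {B} d) = instantiate (P ∧' Q ⇒ P) A B · sound h d
  sound h (∧E₂ {A} {B} d) = instantiate (P ∧' Q ⇒ Q) A B · sound h d
  sound h (∨I₁ {A} {B} d) = instantiate (P ⇒ P ∨' Q) A B · sound h d
  sound h (∨I₂ {A} {B} d) = instantiate (Q ⇒ P ∨' Q) A B · sound h d
  sound h (∨E d e f) =
    ∨-case (sound h d) (λ a → sound (extend h a) e) (λ b → sound (extend h b) f)
  sound h (¬∧I₁ {A} {B} d) = instantiate (¬' P ⇒ ¬' (P ∧' Q)) A B · sound h d
  sound h (¬∧I₂ {A} {B} d) = instantiate (¬' Q ⇒ ¬' (P ∧' Q)) A B · sound h d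
  sound h (¬∧E {A} {B} d e f) =
    ∨-case (instantiate (¬' (P ∧' Q) ⇒ ¬' P ∨' ¬' Q) A B · sound h d)
           (λ a → sound (extend h a) e) (λ b → sound (extend h b) f)
  sound h (¬∨I {A} {B} d e) =
    instantiate (¬' P ⇒ ¬' Q ⇒ ¬' (P ∨' Q)) A B · sound h d · sound h e
  sound h (¬∨E₁ {A} {B} d) = instantiate (¬' (P ∨' Q) ⇒ ¬' P) A B · sound h d
  sound h (¬∨E₂ {A} {B} d) = instantiate (¬' (P ∨' Q) ⇒ ¬' Q) A B · sound h d
  -- Only `P` occurs in the schema; the second `A` is a filler, as in the other one-variable rules.
  sound h (DNI {A} d) = instantiate (P ⇒ ¬' (¬' P)) A A · sound h d
  sound h (DNE {A} d) = instantiate (¬' (¬' P) ⇒ P) A A · sound h d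
  sound h (⇒I {A} {B} d) =
    ∨-case (instantiate (P ∨' (P ⇒ Q)) A B)
           -- If `A` is designated, the subderivation yields `B`, which is then weakened to `A ⇒ B`.
           (λ a → instantiate (Q ⇒ P ⇒ Q) A B · sound (extend h a) d) (λ c → c)
  sound h (⇒E d e) = sound h d · sound h e
  sound h (⇒CL {A} {B}) = instantiate (P ∨' (P ⇒ Q)) A B
  sound h (¬⇒I {A} {B} d e) =
    instantiate (P ⇒ ¬' Q ⇒ ¬' (P ⇒ Q)) A B · sound h d · sound h e
  sound h (¬⇒E₁ {A} {B} d) = instantiate (¬' (P ⇒ Q) ⇒ P) A B · sound h d
  sound h (¬⇒E₂ {A} {B} d) = instantiate (¬' (P ⇒ Q) ⇒ ¬' Q) A B · sound h d
  sound h (EXP∘ {A} {B} d e f) =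
    instantiate (∘ P ⇒ P ⇒ ¬' P ⇒ Q) A B · sound h d · sound h e · sound h f
  sound h (PEM∘ {A} d) = instantiate (∘ P ⇒ P ∨' (¬' P)) A A · sound h d
  sound h (I∘ {A}) = instantiate (∘ (∘ P)) A A
  sound h (I¬∘ {A} d) = instantiate (∘ P ⇒ ∘ (¬' P)) A A · sound h d
  sound h (E¬∘ {A} d) = instantiate (∘ (¬' P) ⇒ ∘ P) A A · sound h d
  sound h (I∧T {A} {B} d e) =
    instantiate (P ᵀ ⇒ Q ᵀ ⇒ (P ∧' Q) ᵀ) A B · sound h d · sound h e
  sound h (I∧F₁ {A} {B} d) = instantiate (P ᶠ ⇒ (P ∧' Q) ᶠ) A B · sound h d
  sound h (I∧F₂ {A} {B} d) = instantiate (Q ᶠ ⇒ (P ∧' Q) ᶠ) A B · sound h d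
  sound h (I∨T₁ {A} {B} d) = instantiate (P ᵀ ⇒ (P ∨' Q) ᵀ) A B · sound h d
  sound h (I∨T₂ {A} {B} d) = instantiate (Q ᵀ ⇒ (P ∨' Q) ᵀ) A B · sound h d
  sound h (I∨F {A} {B} d e) =
    instantiate (P ᶠ ⇒ Q ᶠ ⇒ (P ∨' Q) ᶠ) A B · sound h d · sound h e
  sound h (I⇒T₁ {A} {B} d) = instantiate (P ᶠ ⇒ (P ⇒ Q) ᵀ) A B · sound h d
  sound h (I⇒T₂ {A} {B} d) = instantiate (Q ᵀ ⇒ (P ⇒ Q) ᵀ) A B · sound h d
  sound h (I⇒F {A} {B} d e) =
    instantiate (P ⇒ Q ᶠ ⇒ (P ⇒ Q) ᶠ) A B · sound h d · sound h e
  sound h (E∧T₁ {A} {B} d) = instantiate ((P ∧' Q) ᵀ ⇒ P ᵀ) A B · sound h d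
  sound h (E∧T₂ {A} {B} d) = instantiate ((P ∧' Q) ᵀ ⇒ Q ᵀ) A B · sound h d
  sound h (E∧F {A} {B} d e f) =
    -- A third coordinate 1 in `and3` needs both arguments `T` or one of them `F`; a second
    -- coordinate 1 rules out the former.
    ∨-case (instantiate ((P ∧' Q) ᶠ ⇒ P ᶠ ∨' Q ᶠ) A B · sound h d)
           (λ a → sound (extend h a) e) (λ b → sound (extend h b) f)
  sound h (E∨T {A} {B} d e f) =
    ∨-case (instantiate ((P ∨' Q) ᵀ ⇒ P ᵀ ∨' Q ᵀ) A B · sound h d)
           (λ a → sound (extend h a) e) (λ b → sound (extend h b) f)
  sound h (E∨F₁ {A} {B} d) = instantiate ((P ∨' Q) ᶠ ⇒ P ᶠ) A B · sound h d
  sound h (E∨F₂ {A} {B} d) = instantiate ((P ∨' Q) ᶠ ⇒ Q ᶠ) A B · sound h d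
  sound h (E⇒T {A} {B} d e f) =
    ∨-case (instantiate ((P ⇒ Q) ᵀ ⇒ P ᶠ ∨' Q ᵀ) A B · sound h d)
           (λ a → sound (extend h a) e) (λ b → sound (extend h b) f)
  sound h (E⇒F₁ {A} {B} d) = instantiate ((P ⇒ Q) ᶠ ⇒ P) A B · sound h d
  sound h (E⇒F₂ {A} {B} d) = instantiate ((P ⇒ Q) ᶠ ⇒ Q ᶠ) A B · sound h d

theorem3p12 : (Γ : FSet) (A : For) → Γ ⊢ A → Γ ⊨ A
theorem3p12 Γ A d v h = sound v h d
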